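{- Let $n\ge 1$ and let $D[1\ldots n]$ be an array storing a map $f:[n]\to[n]$ as the sequence $f(1),f(2),\ldots,f(n)$. If it is allowed to modify the elements of the array in the range $[-n,n]$, then there is an algorithm that rearranges $f$ in-place in (nondecreasing) order of its elements, unstably, in $\mathcal{O}(n)$ time using only $4\log n$ bits of additional space in total.
   Context: $[n]=\{1,2,\ldots,n\}$. Computation is on a unit-cost random access machine. "In-place" means that at termination the same array $D[1\ldots n]$ contains the result, here the sequence of the values $f(1),\ldots,f(n)$ arranged in nondecreasing order. During the computation entries of $D$ may be overwritten by integers in $\{ -n,\ldots,n\}$. "Using $c\log n$ bits" means that, besides the array, the algorithm uses $c$ auxiliary variables of $\log n$ bits each (indices or values of magnitude $O(n)$). "Unstably" means that no claim is made about the relative order of equal elements. -}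

module Defs where

open import Data.Fin.Base using (Fin; toℕ; fromℕ<)
open import Data.Integer.Base using (ℤ; +_; -[1+_]; ∣_∣; _+_; _-_; _*_; _/_)
open import Data.Integer.Properties using (_≤?_)
open import Data.List.Base using (List; head; drop)
open import Data.Maybe.Base using (Maybe; just; nothing; _>>=_; map)
open import Data.Nat.Base as ℕ using (ℕ; zero; suc)
open import Data.Nat.Properties using (_<?_)
open import Data.Product.Base using (_×_)
open import Data.Vec.Base using (Vec; lookup; replicate; tabulate; _[_]≔_)
open import Data.Vec.Relation.Unary.All using (All)
open import Relation.Binary.PropositionalEquality using (_≡_)
open import Relation.Nullary.Decidable using (yes; no)

-- A unit-cost random access machine whose only storage is the array
-- D[1 … n] and k integer registers.  A program is a fixed finite list of
-- instructions, independent of n, with jump targets counted from 0.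

-- The length n of the array belongs to the input and can be read, not
-- written, through the operand len.
data Operand (k : ℕ) : Set where
  reg : Fin k → Operand k
  lit : ℤ → Operand k
  len : Operand k

data Arith : Set where
  add sub mul div : Arith

data Instr (k : ℕ) : Set where
  move  : Fin k → Operand k → Instr k
  arith : Arith → Fin k → Operand k → Operand k → Instr k
  -- load r a    is  r := D[a]
  -- store a x   is  D[a] := x
  load  : Fin k → Operand k → Instr k
  store : Operand k → Operand k → Instr k
  goto  : ℕ → Instr k
  -- jump≤ x y ℓ  is  if x ≤ y then goto ℓ
  jump≤ : Operand k → Operand k → ℕ → Instr k
  halt  : Instr k

Program : ℕ → Set
Program k = List (Instr k)

record Config (k n : ℕ) : Set where
  constructor config
  field
    pc    : ℕ
    regs  : Vec ℤ k
    array : Vec ℤ n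

open Config public

fetch : ∀ {k} → Program k → ℕ → Maybe (Instr k)
fetch P pc = head (drop pc P)

value : ∀ {k n} → Config k n → Operand k → ℤ
value         c (reg r) = lookup (regs c) r
value         c (lit z) = z
value {n = n} c len     = + n

-- Addresses are 1, …, n; any other address is a fault.
address : ∀ n → ℤ → Maybe (Fin n)
address n (+ zero)  = nothing
address n -[1+ _ ]  = nothing
address n (+ suc i) with i <? n
... | yes i<n = just (fromℕ< i<n)
... | no  _   = nothing

compute : Arith → ℤ → ℤ → Maybe ℤ
compute add x y              = just (x + y)
compute sub x y              = just (x - y)
compute mul x y              = just (x * y)
compute div x (+ zero)       = nothing
compute div x y@(+ (suc _))  = just (x / y)
compute div x y@(-[1+ _ ])   = just (x / y)

next : ∀ {k n} → Config k n → Config k n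
next c = record c { pc = suc (pc c) }

assign : ∀ {k n} → Config k n → Fin k → ℤ → Config k n
assign c r z = next (record c { regs = regs c [ r ]≔ z })

write : ∀ {k n} → Config k n → Fin n → ℤ → Config k n
write c i z = next (record c { array = array c [ i ]≔ z })

-- nothing means that there is no successor: the machine halts or faults.
execute : ∀ {k n} → Instr k → Config k n → Maybe (Config k n)
execute (move r x) c      = just (assign c r (value c x))
execute (arith o r x y) c = map (assign c r) (compute o (value c x) (value c y))
execute {n = n} (load r a) c =
  map (λ i → assign c r (lookup (array c) i)) (address n (value c a))
execute {n = n} (store a x) c =
  map (λ i → write c i (value c x)) (address n (value c a))
execute (goto ℓ) c        = just (record c { pc = ℓ })
execute (jump≤ x y ℓ) c with value c x ≤? value c y
... | yes _ = just (record c { pc = ℓ })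
... | no  _ = just (next c)
execute halt c            = nothing

step : ∀ {k n} → Program k → Config k n → Maybe (Config k n)
step P c = fetch P (pc c) >>= λ i → execute i c

-- Array entries lie in {-n, …, n}, and a register holds log n + O(1) bits:
-- its magnitude is at most W n, for a constant W.
Admissible : ∀ {k n} → ℕ → Config k n → Set
Admissible {n = n} W c =
    All (λ z → ∣ z ∣ ℕ.≤ W ℕ.* n) (regs c)
  × All (λ z → ∣ z ∣ ℕ.≤ n) (array c)

-- Run P W c t c′: from c the program P executes exactly t instructions, the
-- last one being halt in configuration c′, and every configuration on the
-- way, including c and c′, is admissible.
data Run {k n : ℕ} (P : Program k) (W : ℕ) : Config k n → ℕ → Config k n → Set where
  halts : ∀ {c} → Admissible W c → fetch P (pc c) ≡ just halt → Run P W c 1 c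
  steps : ∀ {c c′ c″ t} → Admissible W c → step P c ≡ just c′ →
          Run P W c′ t c″ → Run P W c (suc t) c″

initial : ∀ {k n} → Vec ℤ n → Config k n
initial D = config 0 (replicate _ (+ 0)) D

-- [n] = {1, …, n} is represented by Fin n, whose elements count from 0.
values : ∀ {n} → (Fin n → Fin n) → Vec ℤ n
values f = tabulate (λ i → + suc (toℕ (f i)))

{-# OPTIONS --safe #-}
module Submission where

-- Three linear passes sort the array D in place with four registers.
--
-- Counting replaces D by counters: afterwards D[v] = -c, where c is the
-- number of occurrences of the value v.  As long as the current cell i holds
-- a positive number v, this occurrence of v is counted in D[v]; if D[v] still
-- holds a value itself, that value moves to cell i and the counter of v
-- starts at 1.  Each visit to the loop head counts one value or moves on to
-- the next cell, so there are at most 2 n visits.  The invariant is that the multiset represented by values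
-- and counters together (content) does not change; since it has n elements,
-- no counter exceeds n.
--
-- Compacting reads the counters from left to right and rewrites the sorted
-- list as a sequence of blocks of equal values.  The value of the k-th block
-- goes to cell k, as an absolute value, and the sign of cell p tells whether a
-- block starts at position p of the sorted list.  The two kinds of
-- information do not collide: the k-th block starts at position k or later,
-- its value comes from a cell at k or later, and a cell holding a counter -c
-- is marked by replacing it with 1 + c, which also marks the counter 0.  This
-- stays within the range unless c = n, and then all values are equal and no
-- mark is placed (count-<); the first position needs no mark.  Encodes describes
-- the final encoding and Scanned the state between two cells, which
-- scanned-block and scanned-skip maintain.
--
-- Expanding fills D from right to left.  The block of position j is the j-th
-- or an earlier one, so the cells up to j still contain everything that is
-- needed to produce the first j elements of the list.
--
-- Programs are verified in the total-correctness judgement Within, which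
-- bounds the number of instructions and the size of all values written, and
-- which is sound for the machine (within-sound).

open import Defs
open import Data.Fin.Base using (Fin)
open import Data.Integer.Properties using (≤-totalOrder)
open import Data.List.Relation.Binary.Permutation.Propositional using (_↭_)
open import Data.List.Relation.Unary.Sorted.TotalOrder ≤-totalOrder using (Sorted)
open import Data.Nat.Base using (ℕ; _≤_; _*_)
open import Data.Product.Base using (Σ; ∃₂; _×_)
open import Data.Vec.Base using (toList)

open import Data.Bool.Base using (Bool; true; false)
open import Data.Empty using (⊥-elim)
open import Data.Fin.Base using (zero; suc; toℕ; fromℕ<)
open import Data.Fin.Properties using (toℕ<n)
open import Data.Integer.Base as ℤ using (ℤ; +_; -[1+_]; ∣_∣; +≤+; -≤+; +<+; -<+)
import Data.Integer.Properties as ℤ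
open import Data.List.Base using (List; []; _∷_; [_]; _++_; _∷ʳ_; length; replicate)
import Data.List.Properties as List
open import Data.List.Relation.Binary.Permutation.Propositional
  using (↭-refl; ↭-sym; ↭-trans; ↭-reflexive; swap)
open import Data.List.Relation.Binary.Permutation.Propositional.Properties
  using (↭-length; drop-∷; shifts) renaming (++⁺ˡ to ↭-++⁺ˡ; ++⁺ʳ to ↭-++⁺ʳ)
open import Data.List.Relation.Unary.All as All using (All; []; _∷_)
import Data.List.Relation.Unary.All.Properties as All
open import Data.List.Relation.Unary.AllPairs using (AllPairs; []; _∷_)
import Data.List.Relation.Unary.AllPairs.Properties as AllPairs
open import Data.List.Relation.Unary.Sorted.TotalOrder.Properties using (AllPairs⇒Sorted)
open import Data.Maybe.Base as Maybe using (just; _>>=_)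
open import Data.Nat.Base using (zero; suc; _+_; _∸_; _<_; z≤n; s≤s; z<s; NonZero)
open import Data.Nat.Properties
  using ( _≟_; _<?_; ≤-refl; ≤-reflexive; ≤-trans; <-≤-trans; ≤-<-trans; <⇒≤; <⇒≢; ≮⇒≥
        ; ≤∧≢⇒<; <⇒≱; n≮n; n≤1+n; m≤m+n; m≤n+m; m≤n*m; m<m+n; m<n⇒m<1+n
        ; m≤n⇒m≤1+n; m≤n⇒m<n∨m≡n; +-comm; +-suc; +-identityʳ; +-mono-≤; +-monoˡ-≤
        ; *-monoʳ-≤; *-distribʳ-+; suc-injective; m+[n∸m]≡n; ≤-pred; module ≤-Reasoning)
open import Data.Nat.Solver using (module +-*-Solver)
open import Data.Product.Base using (_,_)
open import Data.Sum.Base using (_⊎_; inj₁; inj₂)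
open import Data.Vec.Base as Vec using (Vec; []; _∷_; lookup; _[_]≔_)
open import Data.Vec.Properties using (length-toList; lookup∘tabulate)
import Data.Vec.Relation.Unary.All as VecAll
import Data.Vec.Relation.Unary.All.Properties as VecAll
open import Function.Base using (_∘_; case_of_)
open import Relation.Binary.PropositionalEquality
  using (_≡_; _≢_; refl; sym; trans; cong; cong₂; subst; subst₂)
open import Relation.Nullary.Decidable using (yes; no)

private variable
  A : Set
  n : ℕ

-- Arrays addressed by natural numbers

-- Cells are numbered from 0, so the machine address of cell p is p + 1.
-- Cells outside the array read as 0, and writing to them has no effect.
at : Vec ℤ n → ℕ → ℤ
at []       p       = + 0
at (z ∷ D) zero    = z
at (z ∷ D) (suc p) = at D p

put : Vec ℤ n → ℕ → ℤ → Vec ℤ n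
put []      p       y = []
put (z ∷ D) zero    y = y ∷ D
put (z ∷ D) (suc p) y = z ∷ put D p y

at-outside : ∀ (D : Vec ℤ n) {p} → n ≤ p → at D p ≡ + 0
at-outside []              n≤p       = refl
at-outside (z ∷ D) {suc p} (s≤s n≤p) = at-outside D n≤p

at-put : ∀ (D : Vec ℤ n) {p y} → p < n → at (put D p y) p ≡ y
at-put (z ∷ D) {zero}  p<n       = refl
at-put (z ∷ D) {suc p} (s≤s p<n) = at-put D p<n

at-put-≢ : ∀ (D : Vec ℤ n) {p q y} → q ≢ p → at (put D p y) q ≡ at D q
at-put-≢ []      q≢p = refl
at-put-≢ (z ∷ D) {zero}  {zero}  q≢p = ⊥-elim (q≢p refl)
at-put-≢ (z ∷ D) {zero}  {suc q} q≢p = refl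
at-put-≢ (z ∷ D) {suc p} {zero}  q≢p = refl
at-put-≢ (z ∷ D) {suc p} {suc q} q≢p = at-put-≢ D (q≢p ∘ cong suc)

lookup≡at : ∀ (D : Vec ℤ n) {p} (p<n : p < n) → lookup D (fromℕ< p<n) ≡ at D p
lookup≡at (z ∷ D) {zero}  p<n       = refl
lookup≡at (z ∷ D) {suc p} (s≤s p<n) = lookup≡at D p<n

update≡put : ∀ (D : Vec ℤ n) {p y} (p<n : p < n) → D [ fromℕ< p<n ]≔ y ≡ put D p y
update≡put (z ∷ D) {zero}  p<n       = refl
update≡put (z ∷ D) {suc p} (s≤s p<n) = cong (z ∷_) (update≡put D p<n)

-- The entries lie in the range from -n to n.
record Bounded {n} (D : Vec ℤ n) : Set where
  field entry-≤ : ∀ p → ∣ at D p ∣ ≤ n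
open Bounded

put-bounded : ∀ {D : Vec ℤ n} {p y} → p < n → Bounded D → ∣ y ∣ ≤ n → Bounded (put D p y)
put-bounded {D = D} {p} {y} p<n bD y≤n .entry-≤ q with q ≟ p
... | yes refl = subst (λ z → ∣ z ∣ ≤ _) (sym (at-put D p<n)) y≤n
... | no  q≢p  = subst (λ z → ∣ z ∣ ≤ _) (sym (at-put-≢ D q≢p)) (entry-≤ bD q)

all-bounded : ∀ {D : Vec ℤ n} → VecAll.All (λ z → ∣ z ∣ ≤ n) D → Bounded D
all-bounded D≤n .entry-≤ = go D≤n
  where
    go : ∀ {m l} {D : Vec ℤ l} → VecAll.All (λ z → ∣ z ∣ ≤ m) D → ∀ p → ∣ at D p ∣ ≤ m
    go VecAll.[]           p       = z≤n
    go (z≤m VecAll.∷ D≤m) zero    = z≤m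
    go (z≤m VecAll.∷ D≤m) (suc p) = go D≤m p

all-update : ∀ {P : A → Set} {xs : Vec A n} i {y} →
             VecAll.All P xs → P y → VecAll.All P (xs [ i ]≔ y)
all-update zero    (px VecAll.∷ pxs) py = py VecAll.∷ pxs
all-update (suc i) (px VecAll.∷ pxs) py = px VecAll.∷ all-update i pxs py

-- Total correctness of machine programs

address-suc : ∀ {p} (p<n : p < n) → address n (+ suc p) ≡ just (fromℕ< p<n)
address-suc {n} {p} p<n with p <? n
... | yes _   = refl
... | no  p≮n = ⊥-elim (p≮n p<n)

-- Within Q t c: started in c, the program halts after at most t
-- instructions in a configuration satisfying Q, and no instruction on the
-- way writes an inadmissible value.  A load needs no bound of its own: it
-- copies an array entry, which is admissible already.
data Within {k n} (P : Program k) (W : ℕ) (Q : Config k n → Set) :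
            ℕ → Config k n → Set where
  halt! : ∀ {c t} → fetch P (pc c) ≡ just halt → Q c → Within P W Q (suc t) c
  move! : ∀ {c t r x} → fetch P (pc c) ≡ just (move r x) →
          ∣ value c x ∣ ≤ W * n →
          Within P W Q t (assign c r (value c x)) → Within P W Q (suc t) c
  arith! : ∀ {c t o r x y z} → fetch P (pc c) ≡ just (arith o r x y) →
           compute o (value c x) (value c y) ≡ just z → ∣ z ∣ ≤ W * n →
           Within P W Q t (assign c r z) → Within P W Q (suc t) c
  load! : ∀ {c t r a p z} → fetch P (pc c) ≡ just (load r a) →
          value c a ≡ + suc p → p < n → at (array c) p ≡ z →
          Within P W Q t (assign c r z) → Within P W Q (suc t) c
  store! : ∀ {c t a x p} → fetch P (pc c) ≡ just (store a x) →
           value c a ≡ + suc p → p < n → ∣ value c x ∣ ≤ n →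
           Within P W Q t (next (record c { array = put (array c) p (value c x) })) →
           Within P W Q (suc t) c
  goto! : ∀ {c t ℓ} → fetch P (pc c) ≡ just (goto ℓ) →
          Within P W Q t (record c { pc = ℓ }) → Within P W Q (suc t) c
  jump! : ∀ {c t x y ℓ} → fetch P (pc c) ≡ just (jump≤ x y ℓ) →
          value c x ℤ.≤ value c y →
          Within P W Q t (record c { pc = ℓ }) → Within P W Q (suc t) c
  pass! : ∀ {c t x y ℓ} → fetch P (pc c) ≡ just (jump≤ x y ℓ) →
          value c y ℤ.< value c x →
          Within P W Q t (next c) → Within P W Q (suc t) c

weaken : ∀ {k n P W Q s t} {c : Config k n} → s ≤ t → Within P W Q s c → Within P W Q t c
weaken (s≤s s≤t) (halt! e q)        = halt! e q
weaken (s≤s s≤t) (move! e b w)      = move! e b (weaken s≤t w)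
weaken (s≤s s≤t) (arith! e v b w)   = arith! e v b (weaken s≤t w)
weaken (s≤s s≤t) (load! e a i v w)  = load! e a i v (weaken s≤t w)
weaken (s≤s s≤t) (store! e a i b w) = store! e a i b (weaken s≤t w)
weaken (s≤s s≤t) (goto! e w)        = goto! e (weaken s≤t w)
weaken (s≤s s≤t) (jump! e x≤y w)    = jump! e x≤y (weaken s≤t w)
weaken (s≤s s≤t) (pass! e y<x w)    = pass! e y<x (weaken s≤t w)

-- What Within claims, in terms of runs of the machine
Runs : ∀ {k n} → Program k → ℕ → (Config k n → Set) → ℕ → Config k n → Set
Runs P W Q t c = ∃₂ λ s c′ → Run P W c s c′ × s ≤ t × Q c′

private
  execute-jump : ∀ {k n ℓ} {c : Config k n} {x y} → value c x ℤ.≤ value c y →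
                 execute (jump≤ x y ℓ) c ≡ just (record c { pc = ℓ })
  execute-jump {c = c} {x} {y} x≤y with value c x ℤ.≤? value c y
  ... | yes _   = refl
  ... | no  x≰y = ⊥-elim (x≰y x≤y)

  execute-pass : ∀ {k n ℓ} {c : Config k n} {x y} → value c y ℤ.< value c x →
                 execute (jump≤ x y ℓ) c ≡ just (next c)
  execute-pass {c = c} {x} {y} y<x with value c x ℤ.≤? value c y
  ... | yes x≤y = ⊥-elim (ℤ.<⇒≱ y<x x≤y)
  ... | no  _   = refl

  execute-load : ∀ {k n p z r a} {c : Config k n} → value c a ≡ + suc p → p < n →
                 at (array c) p ≡ z → execute (load r a) c ≡ just (assign c r z)
  execute-load {r = r} {c = c} a≡p p<n v rewrite a≡p | address-suc p<n =
    cong (just ∘ assign c r) (trans (lookup≡at (array c) p<n) v)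

  execute-store : ∀ {k n p a x} {c : Config k n} → value c a ≡ + suc p → p < n →
                  execute (store a x) c ≡
                  just (next (record c { array = put (array c) p (value c x) }))
  execute-store {c = c} a≡p p<n rewrite a≡p | address-suc p<n =
    cong (λ D → just (next (record c { array = D }))) (update≡put (array c) p<n)

  execute-arith : ∀ {k n o r x y z} {c : Config k n} → compute o (value c x) (value c y) ≡ just z →
                  execute (arith o r x y) c ≡ just (assign c r z)
  execute-arith {r = r} {c = c} = cong (Maybe.map (assign c r))

  prepend : ∀ {k n P W Q t i} {c d : Config k n} → Admissible W c →
            fetch P (pc c) ≡ just i → execute i c ≡ just d →
            Runs P W Q t d → Runs P W Q (suc t) c
  prepend {c = c} adm e x (s , c′ , run , s≤t , q) =
    suc s , c′ , steps adm (trans (cong (_>>= λ i → execute i c) e) x) run , s≤s s≤t , q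

within-sound : ∀ {k n P W Q t} {c : Config k n} .{{_ : NonZero W}} →
               Admissible W c → Within P W Q t c → Runs P W Q t c
within-sound adm (halt! e q) = 1 , _ , halts adm e , s≤s z≤n , q
within-sound adm@(regs≤ , array≤) (move! {r = r} e b w) =
  prepend adm e refl (within-sound (all-update r regs≤ b , array≤) w)
within-sound {c = c} adm@(regs≤ , array≤) (arith! {o = o} {r} {x} {y} e v b w) =
  prepend adm e (execute-arith {o = o} {r} {x} {y} {c = c} v)
          (within-sound (all-update r regs≤ b , array≤) w)
within-sound {n = n} {W = W} adm@(regs≤ , array≤)
             (load! {r = r} {a} {p} {z} e a≡p p<n v w) =
  prepend adm e (execute-load {a = a} a≡p p<n v) (within-sound (all-update r regs≤ z≤Wn , array≤) w)
  where
    z≤Wn : ∣ z ∣ ≤ W * n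
    z≤Wn = ≤-trans (subst (λ y → ∣ y ∣ ≤ n) v (entry-≤ (all-bounded array≤) p)) (m≤n*m n W)
within-sound {c = c} adm@(regs≤ , array≤) (store! {a = a} {x} e v p<n b w) =
  prepend adm e (execute-store {a = a} {x} v p<n)
          (within-sound (regs≤ , subst (VecAll.All _) (update≡put (array c) p<n)
                                       (all-update (fromℕ< p<n) array≤ b)) w)
within-sound adm (goto! e w) = prepend adm e refl (within-sound adm w)
within-sound {c = c} adm (jump! {x = x} {y} e x≤y w) =
  prepend adm e (execute-jump {c = c} {x} {y} x≤y) (within-sound adm w)
within-sound {c = c} adm (pass! {x = x} {y} e y<x w) =
  prepend adm e (execute-pass {c = c} {x} {y} y<x) (within-sound adm w)

-- Concatenating lists attached to the cells

-- gather F j m = F j ++ F (j + 1) ++ ... ++ F (j + m - 1)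
gather : (ℕ → List A) → ℕ → ℕ → List A
gather F j zero    = []
gather F j (suc m) = F j ++ gather F (suc j) m

gather-++ : ∀ (F : ℕ → List A) j l m →
            gather F j (l + m) ≡ gather F j l ++ gather F (j + l) m
gather-++ F j zero    m rewrite +-identityʳ j = refl
gather-++ F j (suc l) m rewrite +-suc j l | gather-++ F (suc j) l m =
  sym (List.++-assoc (F j) _ _)

gather-snoc : ∀ (F : ℕ → List A) m → gather F 0 (suc m) ≡ gather F 0 m ++ F m
gather-snoc F m =
  trans (cong (gather F 0) (+-comm 1 m))
        (trans (gather-++ F 0 m 1) (cong (gather F 0 m ++_) (List.++-identityʳ (F m))))

gather-cong : ∀ {F F′ : ℕ → List A} j m → (∀ p → j ≤ p → p < j + m → F p ≡ F′ p) →
              gather F j m ≡ gather F′ j m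
gather-cong j zero    F≗ = refl
gather-cong j (suc m) F≗ =
  cong₂ _++_ (F≗ j ≤-refl (m<m+n j z<s))
             (gather-cong (suc j) m λ p j<p p<j+m → F≗ p (<⇒≤ j<p) (subst (p <_) (sym (+-suc j m)) p<j+m))

length-gather-≤ : ∀ (F : ℕ → List A) {l m} → l ≤ m → length (gather F 0 l) ≤ length (gather F 0 m)
length-gather-≤ F {l} {m} l≤m
  rewrite sym (m+[n∸m]≡n l≤m) | gather-++ F 0 l (m ∸ l)
        | List.length-++ (gather F 0 l) {gather F l (m ∸ l)} =
  m≤m+n _ _

length-gather-snoc : ∀ (F : ℕ → List A) m →
                     length (gather F 0 (suc m)) ≡ length (gather F 0 m) + length (F m)
length-gather-snoc F m rewrite gather-snoc F m = List.length-++ (gather F 0 m)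

length-cell-≤ : ∀ (F : ℕ → List A) {p m} → p < m → length (F p) ≤ length (gather F 0 m)
length-cell-≤ F {p} p<m =
  ≤-trans (m≤n+m _ _) (≤-trans (≤-reflexive (sym (length-gather-snoc F p))) (length-gather-≤ F p<m))

-- Changing the list of one cell i from F i to F′ i trades xs for ys.
gather-exchange : ∀ {F F′ : ℕ → List A} {xs ys i} j m → j ≤ i → i < j + m →
                  (∀ p → p ≢ i → F p ≡ F′ p) → xs ++ F i ↭ ys ++ F′ i →
                  xs ++ gather F j m ↭ ys ++ gather F′ j m
gather-exchange j zero j≤i i<j+m F≗ ex =
  ⊥-elim (<⇒≱ i<j+m (subst (_≤ _) (sym (+-identityʳ j)) j≤i))
gather-exchange {F = F} {F′} {xs} {ys} {i} j (suc m) j≤i i<j+m F≗ ex with j ≟ i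
... | yes refl
  rewrite gather-cong {F = F} {F′} (suc j) m (λ p j<p _ → F≗ p (<⇒≢ j<p ∘ sym))
  = subst₂ _↭_ (List.++-assoc xs _ _) (List.++-assoc ys _ _) (↭-++⁺ʳ (gather F′ (suc j) m) ex)
... | no j≢i rewrite F≗ j j≢i =
  ↭-trans (shifts xs (F′ j))
  (↭-trans (↭-++⁺ˡ (F′ j)
             (gather-exchange (suc j) m (≤∧≢⇒< j≤i j≢i) (subst (i <_) (+-suc j m) i<j+m) F≗ ex))
           (shifts (F′ j) ys))

put-exchange : ∀ (g : ℕ → ℤ → List A) {D : Vec ℤ n} {i y z xs ys} → i < n → at D i ≡ y →
               xs ++ g i y ↭ ys ++ g i z →
               xs ++ gather (λ p → g p (at D p)) 0 n ↭ ys ++ gather (λ p → g p (at (put D i z) p)) 0 n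
put-exchange {n = n} g {D} {i} {z = z} {xs} {ys} i<n refl ex =
  gather-exchange {i = i} 0 n z≤n i<n (λ p p≢i → cong (g p) (sym (at-put-≢ D p≢i)))
    (subst (λ w → xs ++ g i (at D i) ↭ ys ++ g i w) (sym (at-put D i<n)) ex)

gather-shift : ∀ (F : ℕ → List A) j m → gather F (suc j) m ≡ gather (F ∘ suc) j m
gather-shift F j zero    = refl
gather-shift F j (suc m) = cong (F (suc j) ++_) (gather-shift F (suc j) m)

toList≡gather : ∀ (D : Vec ℤ n) → toList D ≡ gather (λ p → [ at D p ]) 0 n
toList≡gather []      = refl
toList≡gather {suc m} (z ∷ D) =
  cong (z ∷_) (trans (toList≡gather D) (sym (gather-shift (λ p → [ at (z ∷ D) p ]) 0 m)))

-- copies c p: the value p + 1, repeated c p times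
copies : (ℕ → ℕ) → ℕ → List ℤ
copies c p = replicate (c p) (+ suc p)

gather-copies-≥ : ∀ c j m → All (+ suc j ℤ.≤_) (gather (copies c) j m)
gather-copies-≥ c j zero    = []
gather-copies-≥ c j (suc m) =
  All.++⁺ (All.replicate⁺ (c j) ℤ.≤-refl)
          (All.map (ℤ.≤-trans (+≤+ (n≤1+n (suc j)))) (gather-copies-≥ c (suc j) m))

gather-copies-sorted : ∀ c j m → Sorted (gather (copies c) j m)
gather-copies-sorted c j m = AllPairs⇒Sorted ≤-totalOrder (go j m)
  where
    constant : ∀ l {z} → AllPairs ℤ._≤_ (replicate l z)
    constant zero    = []
    constant (suc l) = All.replicate⁺ l ℤ.≤-refl ∷ constant l

    go : ∀ j m → AllPairs ℤ._≤_ (gather (copies c) j m)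
    go j zero    = []
    go j (suc m) =
      AllPairs.++⁺ (constant (c j)) (go (suc j) m)
        (All.replicate⁺ (c j) (All.map (ℤ.≤-trans (+≤+ (n≤1+n (suc j)))) (gather-copies-≥ c (suc j) m)))

-- Counting the values in place

positive : ℤ → Bool
positive (+ suc _) = true
positive _         = false

positive⇒0< : ∀ {z} → positive z ≡ true → + 0 ℤ.< z
positive⇒0< {+ suc _} _ = +<+ z<s

nonpositive⇒≤0 : ∀ {z} → positive z ≡ false → z ℤ.≤ + 0
nonpositive⇒≤0 {+ zero}   _ = +≤+ z≤n
nonpositive⇒≤0 { -[1+ _ ]} _ = -≤+

-- A partly counted array stands for a multiset of values: a positive entry
-- is a value still to be counted, and an entry -c in cell p is a counter
-- that represents c occurrences of the value p + 1.
cell : ℕ → ℤ → List ℤ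
cell p (+ suc v)  = [ + suc v ]
cell p (+ zero)   = []
cell p (-[1+ c ]) = replicate (suc c) (+ suc p)

content : Vec ℤ n → List ℤ
content {n} D = gather (λ p → cell p (at D p)) 0 n

uncounted : ℤ → List ℤ
uncounted (+ suc v) = [ + suc v ]
uncounted _         = []

-- the number of values still to be counted
remaining : Vec ℤ n → ℕ
remaining {n} D = length (gather (λ p → uncounted (at D p)) 0 n)

cell-nonpositive : ∀ {p z} → positive z ≡ false → cell p z ≡ replicate ∣ z ∣ (+ suc p)
cell-nonpositive {z = + zero}   _ = refl
cell-nonpositive {z = -[1+ _ ]} _ = refl

-- D′ arises from D by counting one occurrence of a value; cell i is the
-- only one that may hold a value still to be counted without having held
-- one in D.
record Counts (i : ℕ) (D D′ : Vec ℤ n) : Set where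
  field
    content↭   : content D′ ↭ content D
    remaining≡ : remaining D ≡ suc (remaining D′)
    settled    : ∀ {p} → p ≢ i → positive (at D p) ≡ false → positive (at D′ p) ≡ false

put-nonpositive : ∀ (D : Vec ℤ n) {p q y} → p < n → positive y ≡ false →
                  positive (at D q) ≡ false → positive (at (put D p y) q) ≡ false
put-nonpositive D {p} {q} p<n y≤0 Dq≤0 with q ≟ p
... | yes refl = trans (cong positive (at-put D p<n)) y≤0
... | no  q≢p  = trans (cong positive (at-put-≢ D q≢p)) Dq≤0

-- If cell v, in which the value v + 1 is counted, itself still holds a value
-- x + 1, that value moves to cell i and the counter starts at 1.
start-counter : ∀ {D : Vec ℤ n} {i v x} → i < n → v < n → at D i ≡ + suc v → at D v ≡ + suc x →
                Counts i D (put (put D i (+ suc x)) v -[1+ 0 ])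
start-counter {n} {D} {i} {v} {x} i<n v<n Di Dv = record
  { content↭   = ↭-sym (drop-∷ (↭-trans
      (put-exchange cell {D} {xs = [ + suc x ]} {[ + suc v ]} i<n Di (swap _ _ ↭-refl))
      (put-exchange cell {D₁} {xs = [ + suc v ]} {[ + suc x ]} v<n D₁v (swap _ _ ↭-refl))))
  ; remaining≡ = suc-injective (trans
      (↭-length (put-exchange (λ _ → uncounted) {D} {xs = [ + suc x ]} {[ + suc v ]} i<n Di (swap _ _ ↭-refl)))
      (cong suc (↭-length (put-exchange (λ _ → uncounted) {D₁} {xs = []} {[ + suc x ]} v<n D₁v ↭-refl))))
  ; settled    = λ p≢i Dp≤0 → put-nonpositive D₁ v<n refl (trans (cong positive (at-put-≢ D p≢i)) Dp≤0)
  }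
  where
    D₁ : Vec ℤ n
    D₁ = put D i (+ suc x)
    D₁v : at D₁ v ≡ + suc x
    D₁v with v ≟ i
    ... | yes refl = at-put D i<n
    ... | no  v≢i  = trans (at-put-≢ D v≢i) Dv

increment-counter : ∀ {D : Vec ℤ n} {i v z} → i < n → v < n →
                    at D i ≡ + suc v → at D v ≡ z → positive z ≡ false →
                    Counts i D (put (put D i (+ 0)) v (-[1+ 0 ] ℤ.+ z))
increment-counter {n} {D} {i} {v} {z} i<n v<n Di Dv z≤0 = record
  { content↭   = ↭-sym (↭-trans
      (put-exchange cell {D} {xs = []} {[ + suc v ]} i<n Di ↭-refl)
      (put-exchange cell {D₁} {xs = [ + suc v ]} {[]} v<n D₁v (↭-reflexive (incremented z≤0))))
  ; remaining≡ = trans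
      (↭-length (put-exchange (λ _ → uncounted) {D} {xs = []} {[ + suc v ]} i<n Di ↭-refl))
      (cong suc (↭-length (put-exchange (λ _ → uncounted) {D₁} {xs = []} {[]} v<n D₁v
        (↭-reflexive (uncounted≡ z≤0)))))
  ; settled    = λ p≢i Dp≤0 →
      put-nonpositive D₁ v<n (negative z≤0) (trans (cong positive (at-put-≢ D p≢i)) Dp≤0)
  }
  where
    D₁ : Vec ℤ n
    D₁ = put D i (+ 0)
    D₁v : at D₁ v ≡ z
    D₁v = trans (at-put-≢ D v≢i) Dv
      where
        v≢i : v ≢ i
        v≢i refl with () ← trans (cong positive (trans (sym Di) Dv)) z≤0
    incremented : ∀ {z} → positive z ≡ false → + suc v ∷ cell v z ≡ cell v (-[1+ 0 ] ℤ.+ z)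
    incremented {+ zero}   _ = refl
    incremented { -[1+ _ ]} _ = refl
    uncounted≡ : ∀ {z} → positive z ≡ false → uncounted z ≡ uncounted (-[1+ 0 ] ℤ.+ z)
    uncounted≡ {+ zero}   _ = refl
    uncounted≡ { -[1+ _ ]} _ = refl
    negative : ∀ {z} → positive z ≡ false → positive (-[1+ 0 ] ℤ.+ z) ≡ false
    negative {+ zero}   _ = refl
    negative { -[1+ _ ]} _ = refl

-- Sorted lists encoded as blocks of equal values

-- Encodes D k e xs: the cells of D encode the list xs of length e as k
-- blocks of copies.  The absolute value of D k is the value of block k (the
-- blocks are counted from 0), and the sign of D p tells whether a block
-- starts at position p of xs.  Position 0 always starts a block, and the
-- sign of D 0 is irrelevant.
data Encodes (D : ℕ → ℤ) : ℕ → ℕ → List ℤ → Set where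
  empty : Encodes D 0 0 []
  start : ∀ {k e xs w} → Encodes D k e xs → (0 < e → positive (D e) ≡ true) →
          ∣ D k ∣ ≡ w → Encodes D (suc k) (suc e) (xs ∷ʳ + w)
  more  : ∀ {k e xs w} → Encodes D (suc k) e xs → positive (D e) ≡ false →
          ∣ D k ∣ ≡ w → Encodes D (suc k) (suc e) (xs ∷ʳ + w)

encodes-length : ∀ {D k e xs} → Encodes D k e xs → length xs ≡ e
encodes-length empty                    = refl
encodes-length (start {xs = xs} enc _ _) =
  trans (List.length-++ xs) (trans (+-comm _ 1) (cong suc (encodes-length enc)))
encodes-length (more {xs = xs} enc _ _)  =
  trans (List.length-++ xs) (trans (+-comm _ 1) (cong suc (encodes-length enc)))

encodes-≤ : ∀ {D k e xs} → Encodes D k e xs → k ≤ e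
encodes-≤ empty           = z≤n
encodes-≤ (start enc _ _) = s≤s (encodes-≤ enc)
encodes-≤ (more enc _ _)  = ≤-trans (encodes-≤ enc) (n≤1+n _)

encodes-cong : ∀ {D D′ k e xs} → (∀ {p} → p < e → positive (D p) ≡ positive (D′ p)) →
               (∀ {p} → p < k → ∣ D p ∣ ≡ ∣ D′ p ∣) → Encodes D k e xs → Encodes D′ k e xs
encodes-cong sign≡ abs≡ empty = empty
encodes-cong sign≡ abs≡ (start enc s a) =
  start (encodes-cong (sign≡ ∘ m<n⇒m<1+n) (abs≡ ∘ m<n⇒m<1+n) enc)
        (λ 0<e → trans (sym (sign≡ ≤-refl)) (s 0<e)) (trans (sym (abs≡ ≤-refl)) a)
encodes-cong sign≡ abs≡ (more enc s a) =
  more (encodes-cong (sign≡ ∘ m<n⇒m<1+n) abs≡ enc)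
       (trans (sym (sign≡ ≤-refl)) s) (trans (sym (abs≡ ≤-refl)) a)

encodes-replicate : ∀ {D k e xs w} m → Encodes D (suc k) e xs →
                    (∀ {p} → e ≤ p → p < e + m → positive (D p) ≡ false) → ∣ D k ∣ ≡ w →
                    Encodes D (suc k) (e + m) (xs ++ replicate m (+ w))
encodes-replicate {e = e} {xs} zero enc _ _
  rewrite +-identityʳ e | List.++-identityʳ xs = enc
encodes-replicate {D} {k} {e} {xs} {w} (suc m) enc unmarked a =
  subst₂ (Encodes D (suc k)) (sym (+-suc e m)) (List.++-assoc xs [ + w ] _)
    (encodes-replicate m (more enc (unmarked ≤-refl (m<m+n e z<s)) a)
      (λ {p} e<p p<e+m → unmarked (<⇒≤ e<p) (subst (p <_) (sym (+-suc e m)) p<e+m)) a)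

-- The two ways in which the part before position e can be encoded, if k is
-- the block of position e.
data Preceded (D : ℕ → ℤ) (k e : ℕ) (xs : List ℤ) : Set where
  by-block : Encodes D k e xs → (0 < e → positive (D e) ≡ true) → Preceded D k e xs
  by-copy  : Encodes D (suc k) e xs → positive (D e) ≡ false → Preceded D k e xs

encodes-suc : ∀ {D k e xs} → Encodes D k (suc e) xs →
              ∃₂ λ l ys → k ≡ suc l × xs ≡ ys ∷ʳ + ∣ D l ∣ × Preceded D l e ys
encodes-suc (start enc s refl) = _ , _ , refl , refl , by-block enc s
encodes-suc (more enc s refl)  = _ , _ , refl , refl , by-copy enc s

-- The counter held by a cell that is not yet overwritten: an unmarked cell holds -c, and a cell
-- marked as the start of a block holds 1 + c.
count : ℤ → ℕ
count (+ zero)   = 0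
count (+ suc c)  = c
count (-[1+ c ]) = suc c

count-nonpositive : ∀ {z} → positive z ≡ false → count z ≡ ∣ z ∣
count-nonpositive {+ zero}   _ = refl
count-nonpositive { -[1+ _ ]} _ = refl

-- The list of the copies of the values 1, ..., v
prefix : (ℕ → ℕ) → ℕ → List ℤ
prefix c = gather (copies c) 0

prefix-suc : ∀ c v → prefix c (suc v) ≡ prefix c v ++ copies c v
prefix-suc c = gather-snoc (copies c)

length-prefix-suc : ∀ c v → length (prefix c (suc v)) ≡ length (prefix c v) + c v
length-prefix-suc c v =
  trans (length-gather-snoc (copies c) v) (cong (λ l → length (prefix c v) + l) (List.length-replicate (c v)))

-- No value occurs n times among n values if the values 1, ..., v occur
-- at least once but fewer than n times in total.
count-< : ∀ {c n v e} → length (prefix c n) ≡ n → length (prefix c v) ≡ e →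
          0 < e → e < n → ∀ {p} → p < n → c p < n
count-< {c} {n} {v} {e} total length≡ 0<e e<n {p} p<n with p <? v
... | yes p<v = ≤-<-trans (≤-trans (≤-reflexive (sym (List.length-replicate (c p))))
                            (≤-trans (length-cell-≤ (copies c) p<v) (≤-reflexive length≡))) e<n
... | no  p≮v = begin
    1 + c p                     ≤⟨ +-monoˡ-≤ (c p) 0<e ⟩
    e + c p                     ≡⟨ cong (_+ c p) (sym length≡) ⟩
    length (prefix c v) + c p   ≤⟨ +-monoˡ-≤ (c p) (length-gather-≤ (copies c) (≮⇒≥ p≮v)) ⟩
    length (prefix c p) + c p   ≡⟨ sym (length-prefix-suc c p) ⟩
    length (prefix c (suc p))   ≤⟨ length-gather-≤ (copies c) p<n ⟩
    length (prefix c n)         ≡⟨ total ⟩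
    n                           ∎
  where open ≤-Reasoning

-- The state after the counters c 0, ..., c (v - 1) have been read, which
-- together are e: the first k cells hold the values among 1, ..., v that
-- occur, and the cells from k on still represent their counters, including
-- those already read.  The start mark at position e, where the next block
-- will start, is already placed; it is only required inside the array.
record Scanned (n : ℕ) (c : ℕ → ℕ) (D : ℕ → ℤ) (v k e : ℕ) : Set where
  field
    encoded : Encodes D k e (prefix c v)
    counted : ∀ {p} → k ≤ p → count (D p) ≡ c p
    opened  : 0 < e → e < n → positive (D e) ≡ true
    fresh   : ∀ {p} → e < p → positive (D p) ≡ false
    k≤v     : k ≤ v

  length≡ : length (prefix c v) ≡ e
  length≡ = encodes-length encoded

  k≤e : k ≤ e
  k≤e = encodes-≤ encoded

  next-≤ : length (prefix c n) ≡ n → v < n → e + c v ≤ n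
  next-≤ total v<n = subst₂ _≤_ (trans (length-prefix-suc c v) (cong (_+ c v) length≡)) total
                       (length-gather-≤ (copies c) v<n)

scanned-empty : ∀ {n D} → (∀ p → positive (D p) ≡ false) → Scanned n (∣_∣ ∘ D) D 0 0 0
scanned-empty D≤0 = record
  { encoded = empty
  ; counted = λ {p} _ → count-nonpositive (D≤0 p)
  ; opened  = λ ()
  ; fresh   = λ {p} _ → D≤0 p
  ; k≤v     = z≤n
  }

scanned-skip : ∀ {n c D v k e} → c v ≡ 0 → Scanned n c D v k e → Scanned n c D (suc v) k e
scanned-skip {c = c} {D} {v} {k} {e} cv≡0 s = record
  { encoded = subst (Encodes D k e) (sym prefix≡) encoded
  ; counted = counted
  ; opened  = opened
  ; fresh   = fresh
  ; k≤v     = ≤-trans k≤v (n≤1+n v)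
  }
  where
    open Scanned s
    prefix≡ : prefix c (suc v) ≡ prefix c v
    prefix≡ rewrite prefix-suc c v | cv≡0 = List.++-identityʳ (prefix c v)

-- D₁ is D with a start mark added at position e, if that is a cell.
record Marks (n : ℕ) (c : ℕ → ℕ) (e : ℕ) (D D₁ : ℕ → ℤ) : Set where
  field
    unchanged : ∀ {p} → p ≢ e → D₁ p ≡ D p
    marked    : D₁ e ≡ + suc (c e) ⊎ (n ≤ e × D₁ e ≡ D e)

-- A counter m + 1 is read: the position after its block is marked, and the
-- value v + 1 goes to cell k, which keeps its sign.
scanned-block : ∀ {n c D D₁ D₂ v k e m} → Scanned n c D v k e → c v ≡ suc m →
                Marks n c (e + suc m) D D₁ → e + suc m ≤ n →
                (∀ {p} → p ≢ k → D₂ p ≡ D₁ p) → positive (D₂ k) ≡ positive (D₁ k) →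
                ∣ D₂ k ∣ ≡ suc v → Scanned n c D₂ (suc v) (suc k) (e + suc m)
scanned-block {n} {c} {D} {D₁} {D₂} {v} {k} {e} {m} s cv≡ marks e′≤n D₂≡ sign-k abs-k = record
  { encoded = subst₂ (Encodes D₂ (suc k)) (sym (+-suc e m)) (sym prefix≡)
      (encodes-replicate m (start encoded₂ opened₂ abs-k) fresh-block abs-k)
  ; counted = counted₂
  ; opened  = λ _ e′<n → sign-e′ e′<n
  ; fresh   = λ e′<p → trans (sign (<⇒≢ e′<p ∘ sym)) (fresh (≤-<-trans (<⇒≤ e<e′) e′<p))
  ; k≤v     = s≤s k≤v
  }
  where
    open Scanned s
    open Marks marks
    e′ : ℕ
    e′ = e + suc m
    e<e′ : e < e′
    e<e′ = m<m+n e z<s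
    e′≢k : e′ ≢ k
    e′≢k refl = n≮n e′ (≤-<-trans k≤e e<e′)
    sign : ∀ {p} → p ≢ e′ → positive (D₂ p) ≡ positive (D p)
    sign {p} p≢e′ with p ≟ k
    ... | yes refl = trans sign-k (cong positive (unchanged p≢e′))
    ... | no  p≢k  = cong positive (trans (D₂≡ p≢k) (unchanged p≢e′))
    sign-e′ : e′ < n → positive (D₂ e′) ≡ true
    sign-e′ e′<n with marked
    ... | inj₁ m′        = cong positive (trans (D₂≡ e′≢k) m′)
    ... | inj₂ (n≤e′ , _) = ⊥-elim (<⇒≱ e′<n n≤e′)
    encoded₂ : Encodes D₂ k e (prefix c v)
    encoded₂ = encodes-cong
      (λ p<e → sym (sign (<⇒≢ (≤-<-trans (<⇒≤ p<e) e<e′))))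
      (λ p<k → cong ∣_∣ (sym (trans (D₂≡ (<⇒≢ p<k))
                                    (unchanged (<⇒≢ (<-≤-trans p<k (≤-trans k≤e (<⇒≤ e<e′))))))))
      encoded
    opened₂ : 0 < e → positive (D₂ e) ≡ true
    opened₂ 0<e = trans (sign (<⇒≢ e<e′)) (opened 0<e (<-≤-trans e<e′ e′≤n))
    fresh-block : ∀ {p} → suc e ≤ p → p < suc e + m → positive (D₂ p) ≡ false
    fresh-block {p} e<p p<e′ = trans (sign (<⇒≢ (subst (p <_) (sym (+-suc e m)) p<e′))) (fresh e<p)
    counted₂ : ∀ {p} → suc k ≤ p → count (D₂ p) ≡ c p
    counted₂ {p} k<p with p ≟ e′
    ... | no p≢e′ =
      trans (cong count (trans (D₂≡ (<⇒≢ k<p ∘ sym)) (unchanged p≢e′))) (counted (<⇒≤ k<p))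
    ... | yes refl with marked
    ...   | inj₁ m′       = cong count (trans (D₂≡ e′≢k) m′)
    ...   | inj₂ (_ , u) = trans (cong count (trans (D₂≡ e′≢k) u)) (counted (<⇒≤ k<p))
    prefix≡ : prefix c (suc v) ≡ (prefix c v ∷ʳ + suc v) ++ replicate m (+ suc v)
    prefix≡ rewrite prefix-suc c v | cv≡ = sym (List.++-assoc (prefix c v) [ + suc v ] _)

-- The program

private
  pattern r₀ = zero
  pattern r₁ = suc zero
  pattern r₂ = suc (suc zero)
  pattern r₃ = suc (suc (suc zero))

-- The numbers in the comments are positions in the whole program.  The
-- variables i, v, x are in r₀, r₂, r₃.  The register r₁ stays 0, the initial
-- value of k in the next pass.
counting : Program 4
counting =
    move r₀ (lit (+ 1))                        -- 0   i := 1
  ∷ load r₂ (reg r₀)                           -- 1   v := D[i]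
  ∷ jump≤ (reg r₂) (lit (+ 0)) 12
  ∷ load r₃ (reg r₂)                           -- 3   x := D[v]
  ∷ jump≤ (reg r₃) (lit (+ 0)) 8
  ∷ store (reg r₀) (reg r₃)                    -- 5   D[i] := x; D[v] := -1
  ∷ store (reg r₂) (lit -[1+ 0 ])
  ∷ goto 1
  ∷ store (reg r₀) (lit (+ 0))                 -- 8   D[i] := 0; D[v] := x - 1
  ∷ arith add r₃ (lit -[1+ 0 ]) (reg r₃)
  ∷ store (reg r₂) (reg r₃)
  ∷ goto 1
  ∷ arith add r₀ (lit (+ 1)) (reg r₀)          -- 12  i := i + 1
  ∷ jump≤ (reg r₀) len 1
  ∷ []

-- The variables v, k, s, x are in r₀, r₁, r₂, r₃: v is the value whose
-- counter is read, k the number of blocks so far, and s the position where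
-- the next block starts, all counted from 1.  At 19 and 20, x is the
-- counter of v with a minus sign.
compacting : Program 4
compacting =
    move r₀ (lit (+ 1))                        -- 14  v := 1; s := 1
  ∷ move r₂ (lit (+ 1))
  ∷ load r₃ (reg r₀)                           -- 16  x := D[v]
  ∷ jump≤ (reg r₃) (lit (+ 0)) 19
  ∷ arith sub r₃ (lit (+ 1)) (reg r₃)          -- 18  x := 1 - x
  ∷ jump≤ (lit (+ 0)) (reg r₃) 33
  ∷ arith sub r₂ (reg r₂) (reg r₃)             -- 20  s := s - x
  ∷ jump≤ (reg r₂) len 23
  ∷ goto 26
  ∷ load r₃ (reg r₂)                           -- 23  D[s] := 1 - D[s]
  ∷ arith sub r₃ (lit (+ 1)) (reg r₃)
  ∷ store (reg r₂) (reg r₃)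
  ∷ arith add r₁ (lit (+ 1)) (reg r₁)          -- 26  k := k + 1
  ∷ load r₃ (reg r₁)
  ∷ jump≤ (reg r₃) (lit (+ 0)) 31
  ∷ store (reg r₁) (reg r₀)                    -- 29  D[k] := v
  ∷ goto 33
  ∷ arith sub r₃ (lit (+ 0)) (reg r₀)          -- 31  D[k] := -v
  ∷ store (reg r₁) (reg r₃)
  ∷ arith add r₀ (lit (+ 1)) (reg r₀)          -- 33  v := v + 1
  ∷ jump≤ (reg r₀) len 16
  ∷ []

-- The variables j, k, y, x are in r₀, r₁, r₂, r₃: k is the block of
-- position j, and x > 0 if this block starts at j.
expanding : Program 4
expanding =
    move r₀ len                                -- 35  j := n
  ∷ load r₃ (reg r₀)                           -- 36  x := D[j]; y := |D[k]|
  ∷ load r₂ (reg r₁)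
  ∷ jump≤ (lit (+ 0)) (reg r₂) 40
  ∷ arith sub r₂ (lit (+ 0)) (reg r₂)
  ∷ store (reg r₀) (reg r₂)                    -- 40  D[j] := y
  ∷ jump≤ (reg r₃) (lit (+ 0)) 43
  ∷ arith add r₁ (lit -[1+ 0 ]) (reg r₁)       -- 42  k := k - 1
  ∷ arith add r₀ (lit -[1+ 0 ]) (reg r₀)       -- 43  j := j - 1
  ∷ jump≤ (lit (+ 1)) (reg r₀) 36
  ∷ halt
  ∷ []

sorter : Program 4
sorter = counting ++ compacting ++ expanding

-- Verifying the three passes

module Verification {n : ℕ} (0<n : 1 ≤ n) (Q : Vec ℤ n → Set) where

  -- The program halts within t instructions with an array satisfying Q.
  Sorts : ℕ → Config 4 n → Set
  Sorts = Within sorter 2 (λ c → Q (array c))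

  ≤2n : ∀ {m} → m ≤ suc n → m ≤ 2 * n
  ≤2n m≤ = ≤-trans m≤ (+-mono-≤ 0<n (≤-reflexive (sym (+-identityʳ n))))

  -- Counting visits a cell again after each value that it counts, so the
  -- number of visits is at most the number of values still to be counted
  -- plus the number of cells still to be settled.  A visit takes at most 8
  -- instructions, and t is the time bound for the two later passes.
  count-values : ∀ {T} fuel {t i r a b D} → i + suc r ≡ n → remaining D + suc r ≤ fuel →
                 length T ≡ n → Bounded D → content D ↭ T →
                 (∀ {p} → p < i → positive (at D p) ≡ false) →
                 (∀ {a b x D} → Bounded D → content D ↭ T →
                    (∀ p → positive (at D p) ≡ false) →
                    Sorts t (config 14 (x ∷ + 0 ∷ a ∷ b ∷ []) D)) →
                 Sorts (fuel * 8 + t) (config 1 (+ suc i ∷ + 0 ∷ a ∷ b ∷ []) D)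
  count-values zero {D = D} i+r≡n fuel≤ = ⊥-elim (<⇒≱ (≤-trans (m≤n+m _ (remaining D)) fuel≤) z≤n)
  count-values {T} (suc fuel) {t} {i} {r} {a} {b} {D} i+r≡n fuel≤ |T|≡n bD content↭ settled compact =
    visit (at D i) refl
    where
      i<n : i < n
      i<n = subst (i <_) i+r≡n (m<m+n i z<s)

      again : ∀ {D′ a b} → Counts i D D′ → Bounded D′ →
              Sorts (fuel * 8 + t) (config 1 (+ suc i ∷ + 0 ∷ a ∷ b ∷ []) D′)
      again {D′} counts bD′ =
        count-values fuel i+r≡n
          (≤-pred (subst (λ m → m + suc r ≤ suc fuel) C.remaining≡ fuel≤)) |T|≡n bD′
          (↭-trans C.content↭ content↭) (λ p<i → C.settled (<⇒≢ p<i) (settled p<i)) compact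
        where module C = Counts counts

      move-on : positive (at D i) ≡ false →
                ∀ {a b} → Sorts (2 + (fuel * 8 + t)) (config 12 (+ suc i ∷ + 0 ∷ a ∷ b ∷ []) D)
      move-on Di≤0 = arith! refl refl (≤2n (s≤s i<n)) (next-cell r i+r≡n fuel≤)
        where
          settled′ : ∀ {p} → p < suc i → positive (at D p) ≡ false
          settled′ p<1+i with m≤n⇒m<n∨m≡n (≤-pred p<1+i)
          ... | inj₁ p<i  = settled p<i
          ... | inj₂ refl = Di≤0

          next-cell : ∀ r {a b} → i + suc r ≡ n → remaining D + suc r ≤ suc fuel →
                      Sorts (1 + (fuel * 8 + t)) (config 13 (+ suc (suc i) ∷ + 0 ∷ a ∷ b ∷ []) D)
          next-cell zero i+1≡n _ =
            pass! refl (+<+ (s≤s (≤-reflexive n≡1+i)))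
              (weaken (m≤n+m t (fuel * 8)) (compact bD content↭ all-settled))
            where
              n≡1+i : n ≡ suc i
              n≡1+i = trans (sym i+1≡n) (+-comm i 1)
              all-settled : ∀ p → positive (at D p) ≡ false
              all-settled p with p <? n
              ... | yes p<n = settled′ (subst (p <_) n≡1+i p<n)
              ... | no  p≮n = cong positive (at-outside D (≮⇒≥ p≮n))
          next-cell (suc r) i+r≡n fuel≤ =
            jump! refl (+≤+ (subst (suc i <_) i+r≡n′ (m<m+n (suc i) z<s)))
              (count-values fuel i+r≡n′
                 (≤-pred (subst (_≤ suc fuel) (+-suc (remaining D) (suc r)) fuel≤))
                 |T|≡n bD content↭ settled′ compact)
            where
              i+r≡n′ : suc i + suc r ≡ n
              i+r≡n′ = trans (sym (+-suc i (suc r))) i+r≡n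

      visit : ∀ z → at D i ≡ z → Sorts (8 + (fuel * 8 + t)) (config 1 (+ suc i ∷ + 0 ∷ a ∷ b ∷ []) D)
      visit (+ zero)   Di = load! refl refl i<n Di (jump! refl (+≤+ z≤n)
                              (weaken (m≤n+m _ 4) (move-on (cong positive Di))))
      visit (-[1+ _ ]) Di = load! refl refl i<n Di (jump! refl -≤+
                              (weaken (m≤n+m _ 4) (move-on (cong positive Di))))
      visit (+ suc v)  Di = load! refl refl i<n Di (pass! refl (+<+ z<s) (counter (at D v) refl))
        where
          v<n : v < n
          v<n = subst (λ z → ∣ z ∣ ≤ n) Di (entry-≤ bD i)

          increment : ∀ {z} → at D v ≡ z → positive z ≡ false →
                      Sorts (4 + (fuel * 8 + t)) (config 8 (+ suc i ∷ + 0 ∷ + suc v ∷ z ∷ []) D)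
          increment {z} Dv z≤0 =
            store! refl refl i<n z≤n (arith! refl refl (≤2n (≤-trans bound (n≤1+n n)))
              (store! refl refl v<n bound
                (goto! refl (again counts (put-bounded v<n (put-bounded i<n bD z≤n) bound)))))
            where
              counts : Counts i D (put (put D i (+ 0)) v (-[1+ 0 ] ℤ.+ z))
              counts = increment-counter i<n v<n Di Dv z≤0
              -- The counter is at most n since the content has n elements.
              bound : ∣ -[1+ 0 ] ℤ.+ z ∣ ≤ n
              bound = begin
                ∣ -[1+ 0 ] ℤ.+ z ∣                ≡⟨ sym (length-decremented z≤0) ⟩
                length (cell v (-[1+ 0 ] ℤ.+ z))  ≡⟨ cong (length ∘ cell v) (sym D′v) ⟩
                length (cell v (at D′ v))         ≤⟨ length-cell-≤ (λ p → cell p (at D′ p)) v<n ⟩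
                length (content D′)               ≡⟨ ↭-length (Counts.content↭ counts) ⟩
                length (content D)                ≡⟨ trans (↭-length content↭) |T|≡n ⟩
                n                                 ∎
                where
                  open ≤-Reasoning
                  D′ : Vec ℤ n
                  D′ = put (put D i (+ 0)) v (-[1+ 0 ] ℤ.+ z)
                  D′v : at D′ v ≡ -[1+ 0 ] ℤ.+ z
                  D′v = at-put (put D i (+ 0)) v<n
                  length-decremented : ∀ {z} → positive z ≡ false →
                    length (cell v (-[1+ 0 ] ℤ.+ z)) ≡ ∣ -[1+ 0 ] ℤ.+ z ∣
                  length-decremented {+ zero}   _ = refl
                  length-decremented { -[1+ m ]} _ = List.length-replicate (suc (suc m))

          counter : ∀ z → at D v ≡ z →
                    Sorts (6 + (fuel * 8 + t)) (config 3 (+ suc i ∷ + 0 ∷ + suc v ∷ b ∷ []) D)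
          counter (+ suc x)  Dv =
            load! refl refl v<n Dv (pass! refl (+<+ z<s)
              (store! refl refl i<n x<n (store! refl refl v<n 0<n
                (goto! refl (weaken (m≤n+m _ 1)
                  (again (start-counter i<n v<n Di Dv) (put-bounded v<n (put-bounded i<n bD x<n) 0<n)))))))
            where
              x<n : x < n
              x<n = subst (λ z → ∣ z ∣ ≤ n) Dv (entry-≤ bD v)
          counter (+ zero)   Dv = load! refl refl v<n Dv (jump! refl (+≤+ z≤n) (increment Dv refl))
          counter (-[1+ _ ]) Dv = load! refl refl v<n Dv (jump! refl -≤+ (increment Dv refl))

  module Compaction {c : ℕ → ℕ} (total : length (prefix c n) ≡ n) {t : ℕ}
    (expand : ∀ {k a b x D} → Bounded D → Encodes (at D) k n (prefix c n) →
              Sorts t (config 35 (x ∷ + k ∷ a ∷ b ∷ []) D))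
    where

    mark-value : ∀ {z} → positive z ≡ false → compute sub (+ 1) z ≡ just (+ suc (count z))
    mark-value {+ zero}   _ = refl
    mark-value { -[1+ _ ]} _ = refl

    -- At most s instructions remain for the current cell, and 16 for each
    -- of the r cells after it.
    Scans : ℕ → ℕ → Config 4 n → Set
    Scans r s = Sorts (s + (r * 16 + t))

    mutual
      -- The cell has been marked already if x is positive.  Both forms of a
      -- counter c lead to x = -c at 19.
      read-cell : ∀ r {v k e x D} → v + suc r ≡ n → Bounded D → Scanned n c (at D) v k e →
                  Scans (suc r) 0 (config 16 (+ suc v ∷ + k ∷ + suc e ∷ x ∷ []) D)
      read-cell r {v} {k} {e} {x} {D} v+r≡n bD s = go (at D v) refl
        where
          open Scanned s
          v<n : v < n
          v<n = subst (v <_) v+r≡n (m<m+n v z<s)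
          c≡ : ∀ {z} → at D v ≡ z → c v ≡ count z
          c≡ Dv = trans (sym (counted k≤v)) (cong count Dv)

          absent : c v ≡ 0 → Scans r 12 (config 19 (+ suc v ∷ + k ∷ + suc e ∷ + 0 ∷ []) D)
          absent cv≡0 = jump! refl (+≤+ z≤n)
            (weaken (m≤n+m _ 9) (advance r v+r≡n bD (scanned-skip cv≡0 s)))

          present : ∀ {m} → c v ≡ suc m →
                    Scans r 13 (config 19 (+ suc v ∷ + k ∷ + suc e ∷ -[1+ m ] ∷ []) D)
          present cv≡ = pass! refl -<+ (mark-end r v+r≡n bD s cv≡)

          go : ∀ z → at D v ≡ z → Scans r 16 (config 16 (+ suc v ∷ + k ∷ + suc e ∷ x ∷ []) D)
          go (+ zero) Dv = load! refl refl v<n Dv (jump! refl (+≤+ z≤n)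
            (weaken (m≤n+m _ 2) (absent (c≡ Dv))))
          go (-[1+ m ]) Dv = load! refl refl v<n Dv (jump! refl -≤+
            (weaken (m≤n+m _ 1) (present (c≡ Dv))))
          go (+ suc zero) Dv = load! refl refl v<n Dv (pass! refl (+<+ z<s)
            (arith! refl refl z≤n (weaken (m≤n+m _ 1) (absent (c≡ Dv)))))
          go (+ suc (suc m)) Dv = load! refl refl v<n Dv (pass! refl (+<+ z<s)
            (arith! refl refl (≤2n (m≤n⇒m≤1+n 1+m≤n)) (present (c≡ Dv))))
            where
              1+m≤n : suc m ≤ n
              1+m≤n = ≤-trans (n≤1+n (suc m)) (subst (λ z → ∣ z ∣ ≤ n) Dv (entry-≤ bD v))

      -- The block of the value v + 1 ends at position e′ (not included).  A mark
      -- is needed there unless e′ is the end of the array.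
      mark-end : ∀ r {v k e m D} → v + suc r ≡ n → Bounded D → Scanned n c (at D) v k e → c v ≡ suc m →
                 Scans r 12 (config 20 (+ suc v ∷ + k ∷ + suc e ∷ -[1+ m ] ∷ []) D)
      mark-end r {v} {k} {e} {m} {D} v+r≡n bD s cv≡ =
        arith! refl refl (≤2n (s≤s e′≤n)) decide
        where
          open Scanned s
          v<n : v < n
          v<n = subst (v <_) v+r≡n (m<m+n v z<s)
          e′ : ℕ
          e′ = e + suc m
          e′≤n : e′ ≤ n
          e′≤n = subst (λ l → e + l ≤ n) cv≡ (next-≤ total v<n)
          e<e′ : e < e′
          e<e′ = m<m+n e z<s

          decide : Scans r 11 (config 21 (+ suc v ∷ + k ∷ + suc e′ ∷ -[1+ m ] ∷ []) D)
          decide with e′ <? n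
          ... | no  e′≮n = pass! refl (+<+ (s≤s (≮⇒≥ e′≮n))) (goto! refl (weaken (m≤n+m _ 2)
                  (store-value r {D = D} v+r≡n bD s cv≡ unmarked)))
            where
              unmarked : Marks n c e′ (at D) (at D)
              unmarked = record { unchanged = λ _ → refl ; marked = inj₂ (≮⇒≥ e′≮n , refl) }
          ... | yes e′<n = jump! refl (+≤+ e′<n) (load! refl refl e′<n refl
                  (arith! refl (mark-value (fresh e<e′)) (≤2n (m≤n⇒m≤1+n mark≤n))
                    (store! refl refl e′<n mark≤n
                      (store-value r {D = D} v+r≡n (put-bounded e′<n bD mark≤n) s cv≡ marks))))
            where
              count≡ : count (at D e′) ≡ c e′
              count≡ = counted (≤-trans k≤e (<⇒≤ e<e′))
              length≡′ : length (prefix c (suc v)) ≡ e′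
              length≡′ = trans (length-prefix-suc c v) (cong₂ _+_ length≡ cv≡)
              mark≤n : suc (count (at D e′)) ≤ n
              mark≤n = subst (_< n) (sym count≡)
                         (count-< {v = suc v} total length≡′ (≤-<-trans z≤n e<e′) e′<n e′<n)
              marks : Marks n c e′ (at D) (at (put D e′ (+ suc (count (at D e′)))))
              marks = record
                { unchanged = at-put-≢ D
                ; marked    = inj₁ (trans (at-put D e′<n) (cong (λ l → + suc l) count≡))
                }

      store-value : ∀ r {v k e m x} {D D₁ : Vec ℤ n} → v + suc r ≡ n → Bounded D₁ →
                    Scanned n c (at D) v k e → c v ≡ suc m → Marks n c (e + suc m) (at D) (at D₁) →
                    Scans r 7 (config 26 (+ suc v ∷ + k ∷ + suc (e + suc m) ∷ x ∷ []) D₁)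
      store-value r {v} {k} {e} {m} {x} {D} {D₁} v+r≡n bD₁ s cv≡ marks =
        arith! refl refl (≤2n (s≤s (<⇒≤ k<n))) (go (at D₁ k) refl)
        where
          open Scanned s
          v<n : v < n
          v<n = subst (v <_) v+r≡n (m<m+n v z<s)
          k<n : k < n
          k<n = ≤-<-trans k≤v v<n
          scanned : ∀ {y} → positive y ≡ positive (at D₁ k) → ∣ y ∣ ≡ suc v →
                    Scanned n c (at (put D₁ k y)) (suc v) (suc k) (e + suc m)
          scanned sign abs = scanned-block s cv≡ marks
            (subst (λ l → e + l ≤ n) cv≡ (next-≤ total v<n)) (at-put-≢ D₁)
            (trans (cong positive (at-put D₁ k<n)) sign) (trans (cong ∣_∣ (at-put D₁ k<n)) abs)

          negative : ∀ {z} → positive (at D₁ k) ≡ false →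
                     Scans r 4 (config 31 (+ suc v ∷ + suc k ∷ + suc (e + suc m) ∷ z ∷ []) D₁)
          negative Dk≤0 = arith! refl refl (≤2n (s≤s (<⇒≤ v<n))) (store! refl refl k<n v<n
            (advance r v+r≡n (put-bounded k<n bD₁ v<n) (scanned (sym Dk≤0) refl)))

          go : ∀ z → at D₁ k ≡ z →
               Scans r 6 (config 27 (+ suc v ∷ + suc k ∷ + suc (e + suc m) ∷ x ∷ []) D₁)
          go (+ suc _) Dk = load! refl refl k<n Dk (pass! refl (+<+ z<s) (store! refl refl k<n v<n
            (goto! refl (advance r v+r≡n (put-bounded k<n bD₁ v<n) (scanned (sym (cong positive Dk)) refl)))))
          go (+ zero)   Dk = load! refl refl k<n Dk (jump! refl (+≤+ z≤n) (negative (cong positive Dk)))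
          go (-[1+ _ ]) Dk = load! refl refl k<n Dk (jump! refl -≤+ (negative (cong positive Dk)))

      advance : ∀ r {v k e x D} → v + suc r ≡ n → Bounded D → Scanned n c (at D) (suc v) k e →
                Scans r 2 (config 33 (+ suc v ∷ + k ∷ + suc e ∷ x ∷ []) D)
      advance zero {v} {k} {e} {D = D} v+1≡n bD s =
        arith! refl refl (≤2n (s≤s (≤-reflexive (sym n≡1+v)))) (pass! refl (+<+ (s≤s (≤-reflexive n≡1+v)))
          (expand bD (subst₂ (Encodes (at D) k) e≡n (cong (prefix c) (sym n≡1+v)) encoded)))
        where
          open Scanned s
          n≡1+v : n ≡ suc v
          n≡1+v = trans (sym v+1≡n) (+-comm v 1)
          e≡n : e ≡ n
          e≡n = trans (sym length≡) (trans (cong (length ∘ prefix c) (sym n≡1+v)) total)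
      advance (suc r) {v} v+r≡n bD s =
        arith! refl refl (≤2n (s≤s (<⇒≤ 1+v<n))) (jump! refl (+≤+ 1+v<n) (read-cell r v+r≡n′ bD s))
        where
          v+r≡n′ : suc v + suc r ≡ n
          v+r≡n′ = trans (sym (+-suc v (suc r))) v+r≡n
          1+v<n : suc v < n
          1+v<n = subst (suc v <_) v+r≡n′ (m<m+n (suc v) z<s)

  module Expansion {T : List ℤ} (done : ∀ {D} → toList D ≡ T → Q D) where

    entries : Vec ℤ n → ℕ → ℕ → List ℤ
    entries D = gather (λ p → [ at D p ])

    -- The cells up to j are still to be filled with the encoded list, and
    -- the m later cells already have their final contents ys.
    mutual
      fill : ∀ j {k xs ys a b D} m → suc j + m ≡ n → Bounded D → Encodes (at D) k (suc j) xs →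
             entries D (suc j) m ≡ ys → xs ++ ys ≡ T →
             Sorts (suc j * 9 + 1) (config 36 (+ suc j ∷ + k ∷ a ∷ b ∷ []) D)
      fill j {a = a} {D = D} m j+m≡n bD enc ys≡ T≡ with encodes-suc enc
      ... | k , xs , refl , refl , before =
        load! refl refl j<n refl (load! refl refl k<n refl (absolute (at D k) refl))
        where
          j<n : j < n
          j<n = subst (j <_) j+m≡n (s≤s (m≤m+n j m))
          k<n : k < n
          k<n = <-≤-trans (encodes-≤ enc) j<n

          written : ∀ {z} → at D k ≡ z →
                    Sorts (5 + (j * 9 + 1)) (config 40 (+ suc j ∷ + suc k ∷ + ∣ z ∣ ∷ at D j ∷ []) D)
          written refl = write-cell j m j+m≡n bD before ys≡ (trans (sym (List.++-assoc xs _ _)) T≡)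

          absolute : ∀ z → at D k ≡ z →
                     Sorts (7 + (j * 9 + 1)) (config 38 (+ suc j ∷ + suc k ∷ z ∷ at D j ∷ []) D)
          absolute (+ w)      Dk = jump! refl (+≤+ z≤n) (weaken (m≤n+m _ 1) (written Dk))
          absolute (-[1+ w ]) Dk = pass! refl -<+ (arith! refl refl (≤2n (m≤n⇒m≤1+n 1+w≤n)) (written Dk))
            where
              1+w≤n : suc w ≤ n
              1+w≤n = subst (λ z → ∣ z ∣ ≤ n) Dk (entry-≤ bD k)

      write-cell : ∀ j {k xs ys D} m → suc j + m ≡ n → Bounded D → Preceded (at D) k j xs →
                   entries D (suc j) m ≡ ys → xs ++ + ∣ at D k ∣ ∷ ys ≡ T →
                   Sorts (5 + (j * 9 + 1))
                     (config 40 (+ suc j ∷ + suc k ∷ + ∣ at D k ∣ ∷ at D j ∷ []) D)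
      write-cell j {k} {xs} {ys} {D} m j+m≡n bD before ys≡ T≡ =
        store! refl refl j<n (entry-≤ bD k) (branch before)
        where
          j<n : j < n
          j<n = subst (j <_) j+m≡n (s≤s (m≤m+n j m))
          w : ℤ
          w = + ∣ at D k ∣
          D′ : Vec ℤ n
          D′ = put D j w

          kept : ∀ {l} → Encodes (at D) l j xs → Encodes (at D′) l j xs
          kept enc = encodes-cong (λ p<j → cong positive (sym (at-put-≢ D (<⇒≢ p<j))))
            (λ p<l → cong ∣_∣ (sym (at-put-≢ D (<⇒≢ (<-≤-trans p<l (encodes-≤ enc)))))) enc

          filled : entries D′ j (suc m) ≡ w ∷ ys
          filled = cong₂ _∷_ (at-put D j<n)
            (trans (gather-cong (suc j) m (λ p j<p _ → cong [_] (at-put-≢ D (<⇒≢ j<p ∘ sym)))) ys≡)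

          back : ∀ {l y x} → length xs ≡ j → (0 < j → Encodes (at D) l j xs) →
                 Sorts (2 + (j * 9 + 1)) (config 43 (+ suc j ∷ + l ∷ y ∷ x ∷ []) D′)
          back length≡ enc = step-down j (suc m) (trans (+-suc j m) j+m≡n)
            (put-bounded j<n bD (entry-≤ bD k)) length≡ (kept ∘ enc) filled T≡

          to-block : Encodes (at D) k j xs → positive (at D j) ≡ true →
                     Sorts (4 + (j * 9 + 1)) (config 41 (+ suc j ∷ + suc k ∷ w ∷ at D j ∷ []) D′)
          to-block enc Dj>0 = pass! refl (positive⇒0< Dj>0)
            (arith! refl refl k≤2n (back (encodes-length enc) (λ _ → enc)))
            where
              k≤2n : k ≤ 2 * n
              k≤2n = ≤2n (≤-trans (encodes-≤ enc) (≤-trans (<⇒≤ j<n) (n≤1+n n)))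

          stay : length xs ≡ j → (0 < j → Encodes (at D) (suc k) j xs) → positive (at D j) ≡ false →
                 Sorts (4 + (j * 9 + 1)) (config 41 (+ suc j ∷ + suc k ∷ w ∷ at D j ∷ []) D′)
          stay length≡ enc Dj≤0 = jump! refl (nonpositive⇒≤0 Dj≤0) (weaken (m≤n+m _ 1) (back length≡ enc))

          branch : Preceded (at D) k j xs →
                   Sorts (4 + (j * 9 + 1)) (config 41 (+ suc j ∷ + suc k ∷ w ∷ at D j ∷ []) D′)
          branch (by-copy enc Dj≤0) = stay (encodes-length enc) (λ _ → enc) Dj≤0
          branch (by-block enc opens) with positive (at D j) in sign
          ... | true  = to-block enc sign
          -- Without a mark this is cell 0, and the block number is not used again.
          ... | false = stay (encodes-length enc) (λ 0<j → case opens 0<j of λ ()) sign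

      step-down : ∀ j {k xs ys y x D} m → j + m ≡ n → Bounded D → length xs ≡ j →
                  (0 < j → Encodes (at D) k j xs) → entries D j m ≡ ys → xs ++ ys ≡ T →
                  Sorts (2 + (j * 9 + 1)) (config 43 (+ suc j ∷ + k ∷ y ∷ x ∷ []) D)
      step-down zero {xs = []} {D = D} m refl bD _ _ ys≡ T≡ =
        arith! refl refl z≤n (pass! refl (+<+ z<s)
          (halt! refl (done (trans (toList≡gather D) (trans ys≡ T≡)))))
      step-down (suc j) m j+m≡n bD _ enc ys≡ T≡ =
        arith! refl refl (≤2n (≤-trans (m≤m+n (suc j) m) (≤-trans (≤-reflexive j+m≡n) (n≤1+n n))))
          (jump! refl (+≤+ (s≤s z≤n)) (fill j m j+m≡n bD (enc z<s) ys≡ T≡))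

-- The program as a whole

values-≤ : ∀ (f : Fin n → Fin n) → VecAll.All (λ z → ∣ z ∣ ≤ n) (values f)
values-≤ f = VecAll.tabulate⁺ {f = λ i → + suc (toℕ (f i))} (toℕ<n ∘ f)

-- Counting takes at most 16 n + 1, compacting 16 n + 2 and expanding 9 n + 2
-- instructions.
sorter-correct : ∀ {n} (0<n : 1 ≤ n) (f : Fin n → Fin n) →
                 Within sorter 2
                   (λ c → Sorted (toList (array c)) × toList (array c) ↭ toList (values f))
                   (1 + ((n + n) * 8 + (2 + (n * 16 + (1 + (n * 9 + 1)))))) (initial (values f))
sorter-correct {n@(suc r)} 0<n f =
  move! refl (≤2n (s≤s z≤n))
    (count-values (n + n) refl (≤-reflexive (cong (_+ n) remaining≡n)) (length-toList D₀) D₀-bounded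
       (↭-reflexive content≡) (λ ()) compact)
  where
    D₀ : Vec ℤ n
    D₀ = values f
    open Verification 0<n (λ D → Sorted (toList D) × toList D ↭ toList D₀)

    D₀-bounded : Bounded D₀
    D₀-bounded = all-bounded (values-≤ f)

    at-values : ∀ {p} (p<n : p < n) → at D₀ p ≡ + suc (toℕ (f (fromℕ< p<n)))
    at-values p<n = trans (sym (lookup≡at D₀ p<n)) (lookup∘tabulate (λ i → + suc (toℕ (f i))) (fromℕ< p<n))

    content≡ : content D₀ ≡ toList D₀
    content≡ = trans
      (gather-cong 0 n (λ p _ p<n →
        trans (cong (cell p) (at-values p<n)) (cong [_] (sym (at-values p<n)))))
      (sym (toList≡gather D₀))

    remaining≡n : remaining D₀ ≡ n
    remaining≡n = trans (cong length (trans
      (gather-cong 0 n (λ p _ p<n →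
        trans (cong uncounted (at-values p<n)) (cong [_] (sym (at-values p<n)))))
      (sym (toList≡gather D₀)))) (length-toList D₀)

    compact : ∀ {a b x D} → Bounded D → content D ↭ toList D₀ → (∀ p → positive (at D p) ≡ false) →
              Sorts (2 + (n * 16 + (1 + (n * 9 + 1)))) (config 14 (x ∷ + 0 ∷ a ∷ b ∷ []) D)
    compact {D = D} bD content↭ D≤0 =
      move! refl (≤2n (s≤s z≤n)) (move! refl (≤2n (s≤s z≤n))
        (Compaction.read-cell total expand r refl bD (scanned-empty D≤0)))
      where
        c : ℕ → ℕ
        c p = ∣ at D p ∣
        T : List ℤ
        T = prefix c n
        T↭ : T ↭ toList D₀
        T↭ = ↭-trans (↭-reflexive (gather-cong 0 n (λ p _ _ → sym (cell-nonpositive (D≤0 p))))) content↭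
        total : length T ≡ n
        total = trans (↭-length T↭) (length-toList D₀)

        expand : ∀ {k a b x D} → Bounded D → Encodes (at D) k n T →
                 Sorts (1 + (n * 9 + 1)) (config 35 (x ∷ + k ∷ a ∷ b ∷ []) D)
        expand bD enc = move! refl (≤2n (n≤1+n n))
          (Expansion.fill sorted r 0 (+-identityʳ n) bD enc refl (List.++-identityʳ T))
          where
            sorted : ∀ {D} → toList D ≡ T → Sorted (toList D) × toList D ↭ toList D₀
            sorted D≡T rewrite D≡T = gather-copies-sorted c 0 n , T↭

budget-≤ : ∀ n → 1 ≤ n → 1 + ((n + n) * 8 + (2 + (n * 16 + (1 + (n * 9 + 1))))) ≤ 46 * n
budget-≤ n 0<n = begin
  1 + ((n + n) * 8 + (2 + (n * 16 + (1 + (n * 9 + 1)))))  ≡⟨ solve 1 (λ n →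
    con 1 :+ ((n :+ n) :* con 8 :+ (con 2 :+ (n :* con 16 :+ (con 1 :+ (n :* con 9 :+ con 1)))))
      := con 5 :+ con 41 :* n) refl n ⟩
  5 + 41 * n      ≤⟨ +-monoˡ-≤ (41 * n) (*-monoʳ-≤ 5 0<n) ⟩
  5 * n + 41 * n  ≡⟨ sym (*-distribʳ-+ n 5 41) ⟩
  46 * n          ∎
  where
    open ≤-Reasoning
    open +-*-Solver

theorem4p1 : Σ (Program 4) λ P → ∃₂ λ (W C : ℕ) →
    (n : ℕ) → 1 ≤ n → (f : Fin n → Fin n) →
    ∃₂ λ (t : ℕ) (c : Config 4 n) →
    Run P W (initial (values f)) t c
    × t ≤ C * n
    × Sorted (toList (array c))
    × toList (array c) ↭ toList (values f)
theorem4p1 = sorter , 2 , 46 , λ n 0<n f →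
  let t , c , run , t≤ , sorted , perm = within-sound (initial-admissible f) (sorter-correct 0<n f)
  in t , c , run , ≤-trans t≤ (budget-≤ n 0<n) , sorted , perm
  where
    initial-admissible : ∀ {n} (f : Fin n → Fin n) → Admissible {4} 2 (initial (values f))
    initial-admissible f =
      (z≤n VecAll.∷ z≤n VecAll.∷ z≤n VecAll.∷ z≤n VecAll.∷ VecAll.[]) , values-≤ f
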